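{- Let $A$ be an irreducible $N\times N$ max-plus matrix and let $G=G(A)$, with critical subgraph $G_c$. Let $$B_{m/s}(G)=2\,cd(G)+ep(G)+\max_{H}c(H)+\max_{H}ep(H)-1,$$ where both maxima are over the strongly connected components $H$ of $G_c$, and let $$\mu(A)=\sup\big\{A^{\otimes n}_{i,k}-A^{\otimes n}_{i,j}\ \mid\ i,j,k\in\{1,\dots,N\},\ n\ge B_{m/s}(G),\ A^{\otimes n}_{i,j}\ne-\infty\big\}.$$ For $1\le j\le N$ let $v^j$ be the vector with $v^j_j=0$ and $v^j_k=-\mu(A)$ for $k\neq j$. Then $$n_A\le\max\big\{B_{m/s}(G),\ n_{A,v^1},\ \dots,\ n_{A,v^N}\big\}.$$
   Context: Let $\mathbb{R}_{\max}=\mathbb{R}\cup\{ -\infty\}$; a max-plus matrix has entries in $\mathbb{R}_{\max}$, and $(A\otimes B)_{i,j}=\max_k(A_{i,k}+B_{k,j})$; $A^{\otimes n}$ is the $n$-th power, $A^{\otimes 0}$ having $0$ on the diagonal and $-\infty$ elsewhere. Graphs. A graph is $(V,E)$ with $V$ finite nonempty and $E\subseteq V\times V$ (directed, loops allowed); it is nontrivial if $E\ne\emptyset$. A path is a finite sequence of consecutive edges (repetitions allowed) with a start node and an end node; the empty sequence is allowed (start = end); its length $\ell$ is the number of edges. A path is closed if start = end; elementary if the start nodes of its edges are pairwise distinct; simple if it is empty, or elementary and non-closed. $cd(G)$ is the maximum length of simple paths in $G$. For a nontrivial strongly connected graph $H$, $c(H)$ is the gcd of the lengths of its nonempty closed paths,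 and $ep(H)$ is the smallest integer $k$ such that for every node $i$ of $H$ and every integer $n\ge k$ that is a multiple of $c(H)$ there is a closed path in $H$ of length $n$ starting at $i$. $G(A)$ has nodes $1,\dots,N$, an edge $(i,j)$ iff $A_{i,j}\neq-\infty$, and edge weight $A_{i,j}$. $A$ is irreducible if $G(A)$ is strongly connected and nontrivial. The rate is $\varrho=\sup w_*(\gamma)/\ell(\gamma)$ over nonempty closed paths $\gamma$, where $w_*(\gamma)$ is the sum of the edge weights. A nonempty closed path is critical if it attains $\varrho$; an edge is critical if it lies on a critical closed path; the critical subgraph $G_c$ consists of the critical edges and their incident nodes. Transients. For irreducible $A$ and $v\in\mathbb{R}_{\max}^N$, the sequences $(A^{\otimes n})_{n\ge0}$ and $x_{A,v}(n)=A^{\otimes n}\otimes v$ are eventually periodic, where $f$ is eventually periodic if there are $p\ge1$, $w_p\in\mathbb{R}_{\max}$, $n_p\ge0$ with $f(n+p)=f(n)+w_p$ (adding $w_p$ to every entry) for all $n\ge n_p$; such a $p$ is a period. The transient of $f$ is the smallest nonnegative integer $n_p$ for which this holds; it does not depend on the choice of the period. $n_A$ and $n_{A,v}$ denote the transients of $(A^{\otimes n})_{n}$ and $(x_{A,v}(n))_{n}$ respectively. -}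

module Defs where

open import Level as Level using (Level; 0ℓ)
open import Data.Fin using (Fin)
import Data.Fin as Fin
open import Data.Integer using (+_)
open import Data.List using (List; []; _∷_; length; map)
import Data.List as List
open import Data.List.Membership.Propositional using (_∈_)
open import Data.List.Relation.Unary.Unique.Propositional using (Unique)
open import Data.Nat as ℕ using (ℕ; NonZero)
import Data.Nat.Properties as ℕₚ
open import Data.Nat.Divisibility using (_∣_)
open import Data.Product using (Σ; ∃; ∃-syntax; _×_; _,_; proj₁; uncurry)
open import Data.Rational as ℚ using (ℚ; 0ℚ; ½; Positive)
import Data.Rational.Properties as ℚₚ
open import Data.Sum using (_⊎_; inj₁; inj₂)
open import Data.Vec.Functional using (Vector)
import Data.Vec.Functional as Vector
open import Relation.Binary using (Rel)
import Relation.Binary.Construct.Add.Infimum.Equality as AddInfimumEquality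
import Relation.Binary.Construct.Add.Infimum.NonStrict as AddInfimumOrder
open import Relation.Binary.Construct.Closure.ReflexiveTransitive using (Star; ε; _◅_)
open import Relation.Binary.PropositionalEquality
  using (_≡_; _≢_; sym; trans; cong; subst; module ≡-Reasoning)
open import Relation.Nullary using (yes; no)
open import Relation.Nullary.Construct.Add.Infimum using (_₋; [_]) renaming (⊥₋ to -∞)
open import Relation.Unary using (Pred; Satisfiable; U)

private
  variable
    a p ℓ : Level
    N : ℕ

module _ {X : Set a} (_≤_ : Rel X ℓ) where

  IsUpperBound : Pred X p → X → Set (a Level.⊔ p Level.⊔ ℓ)
  IsUpperBound P u = ∀ x → P x → x ≤ u

  IsSupremum : Pred X p → X → Set (a Level.⊔ p Level.⊔ ℓ)
  IsSupremum P s = IsUpperBound P s × (∀ u → IsUpperBound P u → s ≤ u)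

IsMaximum : Pred ℕ p → ℕ → Set p
IsMaximum P m = P m × (∀ k → P k → k ℕ.≤ m)

IsMinimum : Pred ℕ p → ℕ → Set p
IsMinimum P m = P m × (∀ k → P k → m ℕ.≤ k)

-- m and n are interchangeable, so this says ∣ s m - s n ∣ ≤ δ eventually.
IsCauchy : (ℕ → ℚ) → Set
IsCauchy s = ∀ δ → 0ℚ ℚ.< δ →
  ∃[ K ] (∀ m n → K ℕ.≤ m → K ℕ.≤ n → s m ℚ.≤ s n ℚ.+ δ)

record ℝ : Set where
  constructor mkℝ
  field
    seq    : ℕ → ℚ
    cauchy : IsCauchy seq

open ℝ public

infix 4 _≤ℝ_ _≈ℝ_

_≤ℝ_ : Rel ℝ 0ℓ
x ≤ℝ y = ∀ δ → 0ℚ ℚ.< δ →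
  ∃[ K ] (∀ n → K ℕ.≤ n → seq x n ℚ.≤ seq y n ℚ.+ δ)

_≈ℝ_ : Rel ℝ 0ℓ
x ≈ℝ y = x ≤ℝ y × y ≤ℝ x

private
  0<*½ : ∀ δ → 0ℚ ℚ.< δ → 0ℚ ℚ.< δ ℚ.* ½
  0<*½ δ 0<δ = ℚₚ.*-monoˡ-<-pos ½ 0<δ

  halves : ∀ δ → δ ℚ.* ½ ℚ.+ δ ℚ.* ½ ≡ δ
  halves δ = trans (sym (ℚₚ.*-distribˡ-+ δ ½ ½)) (ℚₚ.*-identityʳ δ)

  interchange : ∀ p q r s → (p ℚ.+ q) ℚ.+ (r ℚ.+ s) ≡ (p ℚ.+ r) ℚ.+ (q ℚ.+ s)
  interchange p q r s = begin
    (p ℚ.+ q) ℚ.+ (r ℚ.+ s)  ≡⟨ ℚₚ.+-assoc p q (r ℚ.+ s) ⟩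
    p ℚ.+ (q ℚ.+ (r ℚ.+ s))  ≡⟨ cong (p ℚ.+_) (ℚₚ.+-assoc q r s) ⟨
    p ℚ.+ ((q ℚ.+ r) ℚ.+ s)  ≡⟨ cong (λ t → p ℚ.+ (t ℚ.+ s)) (ℚₚ.+-comm q r) ⟩
    p ℚ.+ ((r ℚ.+ q) ℚ.+ s)  ≡⟨ cong (p ℚ.+_) (ℚₚ.+-assoc r q s) ⟩
    p ℚ.+ (r ℚ.+ (q ℚ.+ s))  ≡⟨ ℚₚ.+-assoc p r (q ℚ.+ s) ⟨
    (p ℚ.+ r) ℚ.+ (q ℚ.+ s)  ∎
    where open ≡-Reasoning

infixl 6 _+ℝ_ _⊔ℝ_
infix  8 -ℝ_
infixl 7 _·ℝ_ _/ℝ_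

0ℝ : ℝ
0ℝ = mkℝ (λ _ → 0ℚ) λ δ 0<δ → 0 , λ _ _ _ _ →
  subst (0ℚ ℚ.≤_) (sym (ℚₚ.+-identityˡ δ)) (ℚₚ.<⇒≤ 0<δ)

_+ℝ_ : ℝ → ℝ → ℝ
seq    (x +ℝ y) n = seq x n ℚ.+ seq y n
cauchy (x +ℝ y) δ 0<δ with cauchy x (δ ℚ.* ½) (0<*½ δ 0<δ) | cauchy y (δ ℚ.* ½) (0<*½ δ 0<δ)
... | K , hx | L , hy = K ℕ.⊔ L , λ m n m≥ n≥ →
  subst (seq x m ℚ.+ seq y m ℚ.≤_)
    (trans (interchange (seq x n) _ (seq y n) _)
           (cong (seq x n ℚ.+ seq y n ℚ.+_) (halves δ)))
    (ℚₚ.+-mono-≤ (hx m n (ℕₚ.m⊔n≤o⇒m≤o K L m≥) (ℕₚ.m⊔n≤o⇒m≤o K L n≥))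
                 (hy m n (ℕₚ.m⊔n≤o⇒n≤o K L m≥) (ℕₚ.m⊔n≤o⇒n≤o K L n≥)))

-ℝ_ : ℝ → ℝ
seq    (-ℝ x) n = ℚ.- seq x n
cauchy (-ℝ x) δ 0<δ with cauchy x δ 0<δ
... | K , h = K , λ m n m≥ n≥ → begin
  ℚ.- seq x m                    ≡⟨ ℚₚ.+-identityʳ (ℚ.- seq x m) ⟨
  ℚ.- seq x m ℚ.+ 0ℚ             ≡⟨ cong (ℚ.- seq x m ℚ.+_) (ℚₚ.+-inverseˡ δ) ⟨
  ℚ.- seq x m ℚ.+ (ℚ.- δ ℚ.+ δ)  ≡⟨ ℚₚ.+-assoc (ℚ.- seq x m) (ℚ.- δ) δ ⟨
  ℚ.- seq x m ℚ.- δ ℚ.+ δ        ≡⟨ cong (ℚ._+ δ) (ℚₚ.neg-distrib-+ (seq x m) δ) ⟨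
  ℚ.- (seq x m ℚ.+ δ) ℚ.+ δ      ≤⟨ ℚₚ.+-monoˡ-≤ δ (ℚₚ.neg-antimono-≤ (h n m n≥ m≥)) ⟩
  ℚ.- seq x n ℚ.+ δ              ∎
  where open ℚₚ.≤-Reasoning

_⊔ℝ_ : ℝ → ℝ → ℝ
seq    (x ⊔ℝ y) n = seq x n ℚ.⊔ seq y n
cauchy (x ⊔ℝ y) δ 0<δ with cauchy x δ 0<δ | cauchy y δ 0<δ
... | K , hx | L , hy = K ℕ.⊔ L , λ m n m≥ n≥ → ℚₚ.⊔-lub
  (ℚₚ.≤-trans (hx m n (ℕₚ.m⊔n≤o⇒m≤o K L m≥) (ℕₚ.m⊔n≤o⇒m≤o K L n≥))
              (ℚₚ.+-monoˡ-≤ δ (ℚₚ.p≤p⊔q (seq x n) (seq y n))))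
  (ℚₚ.≤-trans (hy m n (ℕₚ.m⊔n≤o⇒n≤o K L m≥) (ℕₚ.m⊔n≤o⇒n≤o K L n≥))
              (ℚₚ.+-monoˡ-≤ δ (ℚₚ.p≤q⊔p (seq x n) (seq y n))))

_·ℝ_ : ∀ r .{{_ : Positive r}} → ℝ → ℝ
seq    (r ·ℝ x) n = seq x n ℚ.* r
cauchy (r ·ℝ x) δ 0<δ = let K , h = cauchy x (δ ℚ.* r⁻¹) 0<δr⁻¹ in K , λ m n m≥ n≥ → begin
  seq x m ℚ.* r                      ≤⟨ ℚₚ.*-monoʳ-≤-nonNeg r {{ℚₚ.pos⇒nonNeg r}} (h m n m≥ n≥) ⟩
  (seq x n ℚ.+ δ ℚ.* r⁻¹) ℚ.* r      ≡⟨ ℚₚ.*-distribʳ-+ r (seq x n) (δ ℚ.* r⁻¹) ⟩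
  seq x n ℚ.* r ℚ.+ δ ℚ.* r⁻¹ ℚ.* r  ≡⟨ cong (seq x n ℚ.* r ℚ.+_) δr⁻¹r≡δ ⟩
  seq x n ℚ.* r ℚ.+ δ                ∎
  where
  open ℚₚ.≤-Reasoning
  instance _ = ℚₚ.pos⇒nonZero r
  r⁻¹ = ℚ.1/ r

  0<δr⁻¹ : 0ℚ ℚ.< δ ℚ.* r⁻¹
  0<δr⁻¹ = subst (ℚ._< δ ℚ.* r⁻¹) (ℚₚ.*-zeroˡ r⁻¹)
    (ℚₚ.*-monoˡ-<-pos r⁻¹ {{ℚₚ.1/pos⇒pos r}} 0<δ)

  δr⁻¹r≡δ : δ ℚ.* r⁻¹ ℚ.* r ≡ δ
  δr⁻¹r≡δ = trans (ℚₚ.*-assoc δ r⁻¹ r)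
    (trans (cong (δ ℚ.*_) (ℚₚ.*-inverseˡ r)) (ℚₚ.*-identityʳ δ))

_/ℝ_ : ℝ → ∀ l .{{_ : NonZero l}} → ℝ
x /ℝ l = _·ℝ_ (+ 1 ℚ./ l) {{ℚₚ.normalize-pos 1 l}} x

ℝmax : Set
ℝmax = ℝ ₋

open AddInfimumEquality _≈ℝ_ public using () renaming (_≈₋_ to _≈_)
open AddInfimumOrder _≤ℝ_ public using () renaming (_≤₋_ to _≤_)

infixl 6 _+_ _-_ _⊔_
infixl 7 _/_

_+_ : ℝmax → ℝmax → ℝmax
-∞    + y     = -∞
[ x ] + -∞    = -∞
[ x ] + [ y ] = [ x +ℝ y ]

_-_ : ℝmax → ℝ → ℝmax
x - y = x + [ -ℝ y ]

_⊔_ : ℝmax → ℝmax → ℝmax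
-∞    ⊔ y     = y
[ x ] ⊔ -∞    = [ x ]
[ x ] ⊔ [ y ] = [ x ⊔ℝ y ]

_/_ : ℝmax → ∀ l .{{_ : NonZero l}} → ℝmax
-∞    / l = -∞
[ x ] / l = [ x /ℝ l ]

Matrix : ℕ → Set
Matrix N = Fin N → Fin N → ℝmax

⨆ : Vector ℝmax N → ℝmax
⨆ = Vector.foldr _⊔_ -∞

infixl 7 _⊗_ _⊗ᵥ_
infixr 8 _^⊗_

_⊗_ : Matrix N → Matrix N → Matrix N
(A ⊗ B) i j = ⨆ λ k → A i k + B k j

_⊗ᵥ_ : Matrix N → Vector ℝmax N → Vector ℝmax N
(A ⊗ᵥ v) i = ⨆ λ k → A i k + v k

identity : Matrix N
identity i j with i Fin.≟ j
... | yes _ = [ 0ℝ ]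
... | no  _ = -∞

_^⊗_ : Matrix N → ℕ → Matrix N
A ^⊗ ℕ.zero  = identity
A ^⊗ ℕ.suc n = A ⊗ A ^⊗ n

-- Nonemptiness of the node set is part of IsStronglyConnected, so that
-- forming the critical subgraph needs no proof that critical paths exist.
record Graph (N : ℕ) : Set₁ where
  field
    V       : Pred (Fin N) 0ℓ
    E       : Rel (Fin N) 0ℓ
    sources : ∀ {i j} → E i j → V i
    targets : ∀ {i j} → E i j → V j

open Graph public

infix 4 _⊆_

_⊆_ : Graph N → Graph N → Set
H ⊆ G = (∀ {i} → V H i → V G i) × (∀ {i j} → E H i j → E G i j)

IsNontrivial : Graph N → Set
IsNontrivial G = ∃[ i ] ∃[ j ] E G i j

Path : Graph N → Rel (Fin N) 0ℓ
Path G = Star (E G)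

module _ {T : Rel (Fin N) 0ℓ} where

  edges : ∀ {i j} → Star T i j → List (Fin N × Fin N)
  edges ε                     = []
  edges {i} (_◅_ {j = k} _ γ) = (i , k) ∷ edges γ

  len : ∀ {i j} → Star T i j → ℕ
  len γ = length (edges γ)

  IsElementary : ∀ {i j} → Star T i j → Set
  IsElementary γ = Unique (map proj₁ (edges γ))

  IsSimple : ∀ {i j} → Star T i j → Set
  IsSimple {i} {j} γ = len γ ≡ 0 ⊎ (IsElementary γ × i ≢ j)

IsStronglyConnected : Graph N → Set
IsStronglyConnected G = Satisfiable (V G) × (∀ {i j} → V G i → V G j → Path G i j)

IsStronglyConnectedComponent : Graph N → Graph N → Set₁
IsStronglyConnectedComponent G H =
  H ⊆ G × IsStronglyConnected H ×
  (∀ H′ → H′ ⊆ G → IsStronglyConnected H′ → H ⊆ H′ → H′ ⊆ H)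

Is-cd : Graph N → ℕ → Set
Is-cd G =
  IsMaximum λ l → ∃[ i ] ∃[ j ] Σ (Path G i j) λ γ → V G i × IsSimple γ × len γ ≡ l

-- Without nonempty closed paths there is no greatest common divisor, and no
-- number satisfies this.
Is-c : Graph N → ℕ → Set
Is-c H =
  IsMaximum λ d → ∀ {i} (γ : Path H i i) → len γ ≢ 0 → d ∣ len γ

-- n is the length of a path, so the minimum is over natural numbers.
Is-ep : Graph N → ℕ → Set
Is-ep H k = ∃[ c ] Is-c H c × IsMinimum (λ m →
  ∀ i → V H i → ∀ n → m ℕ.≤ n → c ∣ n → Σ (Path H i i) λ γ → len γ ≡ n) k

G : Matrix N → Graph N
G A = record
  { V       = U
  ; E       = λ i j → A i j ≢ -∞
  ; sources = _
  ; targets = _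
  }

IsIrreducible : Matrix N → Set
IsIrreducible A = IsStronglyConnected (G A) × IsNontrivial (G A)

module _ (A : Matrix N) where

  weight : ∀ {i j} → Path (G A) i j → ℝmax
  weight γ = List.foldr (λ e w → uncurry A e + w) [ 0ℝ ] (edges γ)

  mean : ∀ {i j} (γ : Path (G A) i j) .{{_ : NonZero (len γ)}} → ℝmax
  mean γ = weight γ / len γ

  IsRate : ℝmax → Set
  IsRate = IsSupremum _≤_ λ x →
    ∃[ i ] Σ (Path (G A) i i) λ γ → Σ (NonZero (len γ)) λ nz → x ≡ mean γ {{nz}}

  IsCriticalPath : ∀ {i} → Path (G A) i i → Set
  IsCriticalPath γ = Σ (NonZero (len γ)) λ nz → ∃[ ϱ ] IsRate ϱ × mean γ {{nz}} ≈ ϱ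

  IsCriticalEdge : Rel (Fin N) 0ℓ
  IsCriticalEdge i j =
    ∃[ k ] Σ (Path (G A) k k) λ γ → IsCriticalPath γ × (i , j) ∈ edges γ

  Gc : Graph N
  Gc = record
    { V       = λ i → ∃[ j ] (IsCriticalEdge i j ⊎ IsCriticalEdge j i)
    ; E       = IsCriticalEdge
    ; sources = λ e → _ , inj₁ e
    ; targets = λ e → _ , inj₂ e
    }

  Is-Bₘₛ : ℕ → Set₁
  Is-Bₘₛ B = ∃[ cd ] ∃[ ep ] ∃[ ĉ ] ∃[ ep̂ ]
    Is-cd (G A) cd ×
    Is-ep (G A) ep ×
    IsMaximum (λ c → ∃[ H ] IsStronglyConnectedComponent Gc H × Is-c H c) ĉ ×
    IsMaximum (λ e → ∃[ H ] IsStronglyConnectedComponent Gc H × Is-ep H e) ep̂ ×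
    B ≡ 2 ℕ.* cd ℕ.+ ep ℕ.+ ĉ ℕ.+ ep̂ ℕ.∸ 1

  -- The differences lie in ℝmax: the subtracted entry a is finite, while
  -- the other entry may be -∞.
  Is-μ : ℕ → ℝ → Set
  Is-μ B μ = IsSupremum _≤_
    (λ x → ∃[ i ] ∃[ j ] ∃[ k ] ∃[ n ] ∃[ a ]
      B ℕ.≤ n × (A ^⊗ n) i j ≡ [ a ] × x ≡ (A ^⊗ n) i k - a)
    [ μ ]

v^ : ℝ → Fin N → Vector ℝmax N
v^ μ j k with k Fin.≟ j
... | yes _ = [ 0ℝ ]
... | no  _ = [ -ℝ μ ]

module _ {I : Set} (f : ℕ → I → ℝmax) where

  PeriodicFrom : ℕ → ℕ → Set
  PeriodicFrom p m =
    ∃[ w ] (∀ n → m ℕ.≤ n → ∀ x → f (n ℕ.+ p) x ≈ f n x + w)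

  -- p is existential because, for the sequences below with A irreducible and
  -- v ≠ -∞, the minimum is the same for every period.
  IsTransient : ℕ → Set
  IsTransient t = ∃[ p ] 1 ℕ.≤ p × IsMinimum (PeriodicFrom p) t

IsMatrixTransient : Matrix N → ℕ → Set
IsMatrixTransient A = IsTransient λ n → uncurry (A ^⊗ n)

IsSystemTransient : Matrix N → Vector ℝmax N → ℕ → Set
IsSystemTransient A v = IsTransient λ n → A ^⊗ n ⊗ᵥ v

{-# OPTIONS --safe #-}
module Submission where

-- Write c for the gcd of the lengths of the closed paths in G(A).
--
-- Finiteness pattern.  Beyond cd + ep, whether an entry (i , j) of A^n is
-- finite depends only on n modulo c (path-of-length): concatenate a simple
-- path from i to j with a closed path at i, which exists because the missing
-- length is at least ep and divisible by c.  Since B ≥ cd + ep, the pattern is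
-- settled from B on, and since A^n is eventually p-periodic, c divides p
-- (period-divisible).
--
-- Columns.  If n ≥ B and the entry (i , j) of A^n is finite, then by the choice
-- of μ no entry of row i exceeds it by more than μ, so it is the i-th entry
-- of A^n ⊗ v^j (column-entry).
--
-- Let t be the maximum in the theorem, n ≥ t, p the period of A and q that of
-- the system with initial vector v^j.  If the entry (i , j) is -∞ at n then
-- it is -∞ at n + p.  Otherwise take a common multiple S ≥ n_A of p and q.  The
-- entry is finite at n, n + p, n + S and n + p + S, and it is the i-th entry
-- of the system there, so the shift by S adds the same W at n and at n + p;
-- at n + S the shift by p adds the matrix increment w, because n + S ≥ n_A.
-- Cancelling W gives the increment w from n to n + p (cancel-drift).  So A^n
-- is p-periodic from t on, with the same w for all entries,
-- and n_A ≤ t by minimality of n_A.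

open import Level using (0ℓ)
open import Data.Fin using (Fin; zero; suc)
import Data.Fin as Fin
open import Data.List using (map)
open import Data.List.Relation.Unary.All.Properties using (¬Any⇒All¬)
open import Data.List.Relation.Unary.AllPairs using ([]; _∷_)
open import Data.List.Relation.Unary.Any using (here; there)
open import Data.List.Membership.Propositional using (_∈_)
import Data.List.Membership.DecPropositional as DecMembership
open import Data.Nat using (ℕ; _≤_; _⊔_; NonZero)
import Data.Nat as ℕ
import Data.Nat.Properties as ℕₚ
open import Data.Nat.Divisibility
  using (_∣_; 1∣_; _∣0; n∣m*n; m∣m*n; ∣-trans; ∣m∣n⇒∣m+n; ∣m+n∣m⇒∣n)
open import Data.Product using (Σ; ∃-syntax; _,_; proj₁; proj₂; uncurry)
open import Data.Rational as ℚ using (ℚ; 0ℚ; ½)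
import Data.Rational.Properties as ℚₚ
open import Data.Rational.Solver using (module +-*-Solver)
open import Data.Sum using (inj₁; inj₂)
open import Data.Vec.Functional using (Vector; foldr)
open import Defs hiding (_≤_; _⊔_)
import Defs as Max
open import Relation.Binary using (Rel; Transitive)
import Relation.Binary.Construct.Add.Infimum.Equality as AddInfimumEquality
import Relation.Binary.Construct.Add.Infimum.NonStrict as AddInfimumOrder
open import Relation.Binary.Construct.Closure.ReflexiveTransitive
  using (Star; ε; _◅_; _◅◅_)
open import Relation.Binary.PropositionalEquality
  using (_≡_; _≢_; refl; sym; trans; cong; subst; module ≡-Reasoning)
open import Relation.Nullary using (yes; no; contradiction)
open import Relation.Nullary.Construct.Add.Infimum using ([_]) renaming (⊥₋ to -∞)
open import Relation.Unary using (Pred)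

open AddInfimumEquality _≈ℝ_ using (⊥₋≈⊥₋; [_]; ≈₋-sym; ≈₋-trans)
open AddInfimumOrder _≤ℝ_ using (⊥₋≤_; [_]; ≤₋-trans; ≤₋-antisym)
open +-*-Solver using (solve; _:=_; _:+_; :-_)

private
  variable
    N p m n : ℕ
    i j k : Fin N

-- Order and addition on the reals

-- This one lemma covers monotonicity of addition, cancellation, and the moving
-- of terms from one side of an inequality to the other.
≤ℝ-translate : ∀ {x y x′ y′} (d : ℕ → ℚ) →
  (∀ n → seq x n ℚ.+ d n ≡ seq x′ n) → (∀ n → seq y n ℚ.+ d n ≡ seq y′ n) →
  x ≤ℝ y → x′ ≤ℝ y′
≤ℝ-translate {x} {y} {x′} {y′} d x+d≡x′ y+d≡y′ x≤y δ 0<δ with x≤y δ 0<δ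
... | K , h = K , λ n K≤n → begin
  seq x′ n                   ≡⟨ x+d≡x′ n ⟨
  seq x n ℚ.+ d n            ≤⟨ ℚₚ.+-monoˡ-≤ (d n) (h n K≤n) ⟩
  seq y n ℚ.+ δ ℚ.+ d n      ≡⟨ solve 3 (λ y δ d → y :+ δ :+ d := y :+ d :+ δ) refl
                                  (seq y n) δ (d n) ⟩
  seq y n ℚ.+ d n ℚ.+ δ      ≡⟨ cong (ℚ._+ δ) (y+d≡y′ n) ⟩
  seq y′ n ℚ.+ δ             ∎
  where open ℚₚ.≤-Reasoning

≤ℝ-pointwise : ∀ {x y} → (∀ n → seq x n ℚ.≤ seq y n) → x ≤ℝ y
≤ℝ-pointwise {x} {y} x≤y δ 0<δ = 0 , λ n _ → begin
  seq x n          ≤⟨ x≤y n ⟩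
  seq y n          ≡⟨ ℚₚ.+-identityʳ (seq y n) ⟨
  seq y n ℚ.+ 0ℚ   ≤⟨ ℚₚ.+-monoʳ-≤ (seq y n) (ℚₚ.<⇒≤ 0<δ) ⟩
  seq y n ℚ.+ δ    ∎
  where open ℚₚ.≤-Reasoning

≤ℝ-trans : Transitive _≤ℝ_
≤ℝ-trans {x} {y} {z} x≤y y≤z δ 0<δ with x≤y (δ ℚ.* ½) 0<δ/2 | y≤z (δ ℚ.* ½) 0<δ/2
  where 0<δ/2 = ℚₚ.*-monoˡ-<-pos ½ 0<δ
... | K , h | L , g = K ⊔ L , λ n K⊔L≤n → begin
  seq x n                            ≤⟨ h n (ℕₚ.m⊔n≤o⇒m≤o K L K⊔L≤n) ⟩
  seq y n ℚ.+ δ ℚ.* ½                ≤⟨ ℚₚ.+-monoˡ-≤ (δ ℚ.* ½) (g n (ℕₚ.m⊔n≤o⇒n≤o K L K⊔L≤n)) ⟩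
  seq z n ℚ.+ δ ℚ.* ½ ℚ.+ δ ℚ.* ½    ≡⟨ ℚₚ.+-assoc (seq z n) (δ ℚ.* ½) (δ ℚ.* ½) ⟩
  seq z n ℚ.+ (δ ℚ.* ½ ℚ.+ δ ℚ.* ½)  ≡⟨ cong (seq z n ℚ.+_) (ℚₚ.*-distribˡ-+ δ ½ ½) ⟨
  seq z n ℚ.+ δ ℚ.* (½ ℚ.+ ½)        ≡⟨ cong (seq z n ℚ.+_) (ℚₚ.*-identityʳ δ) ⟩
  seq z n ℚ.+ δ                      ∎
  where open ℚₚ.≤-Reasoning

≈ℝ-translate : ∀ {x y x′ y′} (d : ℕ → ℚ) →
  (∀ n → seq x n ℚ.+ d n ≡ seq x′ n) → (∀ n → seq y n ℚ.+ d n ≡ seq y′ n) →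
  x ≈ℝ y → x′ ≈ℝ y′
≈ℝ-translate {x} {y} {x′} {y′} d hx hy (x≤y , y≤x) =
  ≤ℝ-translate {x} {y} {x′} {y′} d hx hy x≤y , ≤ℝ-translate {y} {x} {y′} {x′} d hy hx y≤x

≈ℝ-pointwise : ∀ {x y} → (∀ n → seq x n ≡ seq y n) → x ≈ℝ y
≈ℝ-pointwise {x} {y} x≡y =
  ≤ℝ-pointwise {x} {y} (λ n → ℚₚ.≤-reflexive (x≡y n)) ,
  ≤ℝ-pointwise {y} {x} (λ n → ℚₚ.≤-reflexive (sym (x≡y n)))

≈ℝ-sym : ∀ {x y} → x ≈ℝ y → y ≈ℝ x
≈ℝ-sym (x≤y , y≤x) = y≤x , x≤y

≈ℝ-trans : Transitive _≈ℝ_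
≈ℝ-trans {x} {y} {z} (x≤y , y≤x) (y≤z , z≤y) =
  ≤ℝ-trans {x} {y} {z} x≤y y≤z , ≤ℝ-trans {z} {y} {x} z≤y y≤x

≤ℝ-refl : ∀ {x} → x ≤ℝ x
≤ℝ-refl {x} = ≤ℝ-pointwise {x} {x} λ _ → ℚₚ.≤-refl

⊔ℝ-lub : ∀ {x y z} → x ≤ℝ z → y ≤ℝ z → x ⊔ℝ y ≤ℝ z
⊔ℝ-lub x≤z y≤z δ 0<δ with x≤z δ 0<δ | y≤z δ 0<δ
... | K , h | L , g = K ⊔ L , λ n K⊔L≤n →
  ℚₚ.⊔-lub (h n (ℕₚ.m⊔n≤o⇒m≤o K L K⊔L≤n)) (g n (ℕₚ.m⊔n≤o⇒n≤o K L K⊔L≤n))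

-- Order, equality and suprema on the max-plus line

≤-refl : ∀ {x} → x Max.≤ x
≤-refl { -∞}    = ⊥₋≤ _
≤-refl {[ x ]} = [ ≤ℝ-refl {x} ]

≤-trans : ∀ {x y z} → x Max.≤ y → y Max.≤ z → x Max.≤ z
≤-trans = ≤₋-trans λ {x} {y} {z} → ≤ℝ-trans {x} {y} {z}

≈-refl : ∀ {x} → x ≈ x
≈-refl { -∞}    = ⊥₋≈⊥₋
≈-refl {[ x ]} = [ ≤ℝ-refl {x} , ≤ℝ-refl {x} ]

≈-sym : ∀ {x y} → x ≈ y → y ≈ x
≈-sym = ≈₋-sym λ {x} {y} → ≈ℝ-sym {x} {y}

≈-trans : ∀ {x y z} → x ≈ y → y ≈ z → x ≈ z
≈-trans = ≈₋-trans λ {x} {y} {z} → ≈ℝ-trans {x} {y} {z}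

≈-reflexive : ∀ {x y} → x ≡ y → x ≈ y
≈-reflexive refl = ≈-refl

+-congʳ : ∀ {x y} z → x ≈ y → x + z ≈ y + z
+-congʳ z     ⊥₋≈⊥₋ = ⊥₋≈⊥₋
+-congʳ -∞    [ _ ] = ⊥₋≈⊥₋
+-congʳ [ z ] ([_] {x} {y} x≈y) =
  [ ≈ℝ-translate {x} {y} {x +ℝ z} {y +ℝ z} (seq z) (λ _ → refl) (λ _ → refl) x≈y ]

+-assoc : ∀ x y z → (x + y) + z ≈ x + (y + z)
+-assoc -∞    y     z     = ⊥₋≈⊥₋
+-assoc [ x ] -∞    z     = ⊥₋≈⊥₋
+-assoc [ x ] [ y ] -∞    = ⊥₋≈⊥₋
+-assoc [ x ] [ y ] [ z ] =
  [ ≈ℝ-pointwise {x +ℝ y +ℝ z} {x +ℝ (y +ℝ z)}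
      (λ n → ℚₚ.+-assoc (seq x n) (seq y n) (seq z n)) ]

+-identityʳ : ∀ x → x + [ 0ℝ ] ≈ x
+-identityʳ -∞    = ⊥₋≈⊥₋
+-identityʳ [ x ] = [ ≈ℝ-pointwise {x +ℝ 0ℝ} {x} (λ n → ℚₚ.+-identityʳ (seq x n)) ]

-- The subtracted reals a and b change sides; x itself may be -∞.
swap-subtrahend : ∀ x {a b} → x - a Max.≤ [ b ] → x - b Max.≤ [ a ]
swap-subtrahend -∞    _           = ⊥₋≤ _
swap-subtrahend [ x ] {a} {b} [ h ] =
  [ ≤ℝ-translate {x +ℝ (-ℝ a)} {b} {x +ℝ (-ℝ b)} {a} (λ n → seq a n ℚ.- seq b n)
      (λ n → solve 3 (λ x a b → x :+ :- a :+ (a :+ :- b) := x :+ :- b) refl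
               (seq x n) (seq a n) (seq b n))
      (λ n → solve 2 (λ a b → b :+ (a :+ :- b) := a) refl (seq a n) (seq b n)) h ]

-- If a′ and b′ exceed a and b by the same W, and b′ exceeds a′ by w, then b
-- exceeds a by w.  W and w are finite because the left-hand sides are, so W can
-- be cancelled.
cancel-drift : ∀ {a b a′ b′ W w} →
  [ a′ ] ≈ [ a ] + W → [ b′ ] ≈ [ b ] + W → [ b′ ] ≈ [ a′ ] + w → [ b ] ≈ [ a ] + w
cancel-drift {W = -∞} () _ _
cancel-drift {W = [ _ ]} {w = -∞} _ _ ()
cancel-drift {a} {b} {a′} {b′} {[ W ]} {[ w ]} [ a′≈a+W ] [ b′≈b+W ] [ b′≈a′+w ] =
  [ ≈ℝ-translate {b +ℝ W} {a +ℝ W +ℝ w} {b} {a +ℝ w} (λ n → ℚ.- seq W n)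
      (λ n → solve 2 (λ b W → b :+ W :+ :- W := b) refl (seq b n) (seq W n))
      (λ n → solve 3 (λ a W w → a :+ W :+ w :+ :- W := a :+ w) refl
               (seq a n) (seq W n) (seq w n))
      b+W≈a+W+w ]
  where
  a′+w≈a+W+w : a′ +ℝ w ≈ℝ a +ℝ W +ℝ w
  a′+w≈a+W+w = ≈ℝ-translate {a′} {a +ℝ W} {a′ +ℝ w} {a +ℝ W +ℝ w} (seq w)
    (λ _ → refl) (λ _ → refl) a′≈a+W

  b+W≈a+W+w : b +ℝ W ≈ℝ a +ℝ W +ℝ w
  b+W≈a+W+w = ≈ℝ-trans {b +ℝ W} {b′} {a +ℝ W +ℝ w} (≈ℝ-sym {b′} {b +ℝ W} b′≈b+W)
    (≈ℝ-trans {b′} {a′ +ℝ w} {a +ℝ W +ℝ w} b′≈a′+w a′+w≈a+W+w)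

x≤x⊔y : ∀ x y → x Max.≤ x Max.⊔ y
x≤x⊔y -∞    y     = ⊥₋≤ y
x≤x⊔y [ x ] -∞    = ≤-refl
x≤x⊔y [ x ] [ y ] = [ ≤ℝ-pointwise {x} {x ⊔ℝ y} (λ n → ℚₚ.p≤p⊔q (seq x n) (seq y n)) ]

y≤x⊔y : ∀ x y → y Max.≤ x Max.⊔ y
y≤x⊔y -∞    y     = ≤-refl
y≤x⊔y [ x ] -∞    = ⊥₋≤ _
y≤x⊔y [ x ] [ y ] = [ ≤ℝ-pointwise {y} {x ⊔ℝ y} (λ n → ℚₚ.p≤q⊔p (seq x n) (seq y n)) ]

⊔-lub : ∀ {x y z} → x Max.≤ z → y Max.≤ z → x Max.⊔ y Max.≤ z
⊔-lub (⊥₋≤ _) y≤z      = y≤z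
⊔-lub [ x≤z ] (⊥₋≤ _)  = [ x≤z ]
⊔-lub ([_] {x} {z} x≤z) ([_] {y} y≤z) = [ ⊔ℝ-lub {x} {y} {z} x≤z y≤z ]

⨆-upper : (f : Vector ℝmax N) → ∀ k → f k Max.≤ ⨆ f
⨆-upper f zero    = x≤x⊔y (f zero) _
⨆-upper f (suc k) = ≤-trans (⨆-upper (λ l → f (suc l)) k) (y≤x⊔y (f zero) _)

⨆-lub : (f : Vector ℝmax N) → ∀ {y} → (∀ k → f k Max.≤ y) → ⨆ f Max.≤ y
⨆-lub {ℕ.zero}  f f≤y = ⊥₋≤ _
⨆-lub {ℕ.suc N} f f≤y = ⊔-lub (f≤y zero) (⨆-lub (λ l → f (suc l)) λ l → f≤y (suc l))

⨆-attained : (f : Vector ℝmax N) → ∀ j {y} → f j ≈ y → (∀ k → f k Max.≤ y) → ⨆ f ≈ y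
⨆-attained f j {y} fj≈y f≤y =
  ≤₋-antisym _,_ (⨆-lub f f≤y) (≤-trans (≈⇒≥ fj≈y) (⨆-upper f j))
  where
  ≈⇒≥ : ∀ {x y} → x ≈ y → y Max.≤ x
  ≈⇒≥ ⊥₋≈⊥₋       = ⊥₋≤ _
  ≈⇒≥ [ _ , y≤x ] = [ y≤x ]

-- Finite entries

-- Finiteness is the negation of a constructor equation, so that it is
-- definitionally the edge relation of G(A).
Finite : Pred ℝmax 0ℓ
Finite x = x ≢ -∞

finite-value : ∀ {x} → Finite x → ∃[ a ] x ≡ [ a ]
finite-value { -∞}    x≢-∞ = contradiction refl x≢-∞
finite-value {[ a ]} _    = a , refl

finite-≈ : ∀ {x y} → x ≈ y → Finite x → Finite y
finite-≈ ⊥₋≈⊥₋ x≢-∞ = x≢-∞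
finite-≈ [ _ ] _    = λ ()

finite-+ : ∀ {x y} → Finite x → Finite y → Finite (x + y)
finite-+ { -∞}            x≢-∞ _ = x≢-∞
finite-+ {[ _ ]} { -∞}    _ y≢-∞ = y≢-∞
finite-+ {[ _ ]} {[ _ ]} _ _    = λ ()

finite-+ˡ : ∀ {x y} → Finite (x + y) → Finite x
finite-+ˡ { -∞}    x+y≢-∞ = x+y≢-∞
finite-+ˡ {[ _ ]} _      = λ ()

finite-+ʳ : ∀ {x y} → Finite (x + y) → Finite y
finite-+ʳ { -∞}            x+y≢-∞ = contradiction refl x+y≢-∞
finite-+ʳ {[ _ ]} { -∞}    x+y≢-∞ = x+y≢-∞
finite-+ʳ {[ _ ]} {[ _ ]} _      = λ ()

finite-≤ : ∀ {x y} → x Max.≤ y → Finite x → Finite y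
finite-≤ (⊥₋≤ _) x≢-∞ = contradiction refl x≢-∞
finite-≤ [ _ ]   _    = λ ()

finite-⨆ : (f : Vector ℝmax N) → Finite (⨆ f) → ∃[ k ] Finite (f k)
finite-⨆ {ℕ.zero}  f ⨆≢-∞ = contradiction refl ⨆≢-∞
finite-⨆ {ℕ.suc N} f ⨆≢-∞ with f zero in f0≡
... | [ _ ] = zero , λ f0≡-∞ → contradiction (trans (sym f0≡) f0≡-∞) λ ()
... | -∞    with k , fk≢-∞ ← finite-⨆ (λ l → f (suc l)) ⨆≢-∞ = suc k , fk≢-∞

-- Paths of prescribed length

-- Existence of a path of length exactly n; as a relation it is the n-th power of
-- the edge relation.
HasPath : Graph N → ℕ → Rel (Fin N) 0ℓ
HasPath H n i j = Σ (Path H i j) λ γ → len γ ≡ n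

module _ {T : Rel (Fin N) 0ℓ} where

  len-◅◅ : ∀ (γ : Star T i j) (δ : Star T j k) → len (γ ◅◅ δ) ≡ len γ ℕ.+ len δ
  len-◅◅ ε       δ = refl
  len-◅◅ (_ ◅ γ) δ = cong ℕ.suc (len-◅◅ γ δ)

  suffix-from : ∀ (γ : Star T k j) → IsElementary γ → i ∈ map proj₁ (edges γ) →
    Σ (Star T i j) IsElementary
  suffix-from γ@(_ ◅ _) elem        (here refl) = γ , elem
  suffix-from (_ ◅ γ)   (_ ∷ elem)  (there i∈γ) = suffix-from γ elem i∈γ

  -- Loop erasure: when the new start node recurs, everything before its
  -- recurrence is dropped.
  elementary-path : Star T i j → Σ (Star T i j) IsElementary
  elementary-path ε = ε , []
  elementary-path {i = i} (e ◅ γ) with elementary-path γ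
  ... | σ , elem with DecMembership._∈?_ Fin._≟_ i (map proj₁ (edges σ))
  ...   | yes i∈σ = suffix-from σ elem i∈σ
  ...   | no  i∉σ = e ◅ σ , ¬Any⇒All¬ _ i∉σ ∷ elem

  simple-path : Star T i j → Σ (Star T i j) IsSimple
  simple-path {i} {j} γ with i Fin.≟ j
  ... | yes refl = ε , inj₁ refl
  ... | no  i≢j  with σ , elem ← elementary-path γ = σ , inj₂ (elem , i≢j)

module _ (H : Graph N) {c : ℕ} (is-c : Is-c H c) where

  c∣closed : (γ : Path H i i) → c ∣ len γ
  c∣closed γ with len γ ℕ.≟ 0
  ... | yes ℓ≡0 = subst (c ∣_) (sym ℓ≡0) (c ∣0)
  ... | no  ℓ≢0 = proj₁ is-c γ ℓ≢0

1≤c : (H : Graph N) → ∀ {c} → Is-c H c → 1 ≤ c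
1≤c H is-c = proj₂ is-c 1 λ γ _ → 1∣ len γ

-- From cd + ep on, the residue modulo c is the only obstruction to a path of
-- length n from i to j.  Its vanishing is expressed through a return path δ,
-- which avoids the subtraction of lengths.
path-of-length : (H : Graph N) → IsStronglyConnected H → ∀ {cd} → Is-cd H cd →
  ∀ {ep} ((c , _) : Is-ep H ep) → V H i → (δ : Path H j i) → V H j →
  cd ℕ.+ ep ≤ n → c ∣ n ℕ.+ len δ → HasPath H n i j
path-of-length {i = i} {j} {n} H (_ , connected) {cd} is-cd {ep} (c , is-c , closed , _)
  vi δ vj cd+ep≤n c∣n+δ =
  let ρ , lenρ≡ = closed i vi (n ℕ.∸ len σ) ep≤n∸σ c∣n∸σ in
  ρ ◅◅ σ ,
  trans (len-◅◅ ρ σ) (trans (cong (ℕ._+ len σ) lenρ≡) (ℕₚ.m∸n+n≡m σ≤n))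
  where
  σ = proj₁ (simple-path (connected vi vj))

  σ≤cd : len σ ≤ cd
  σ≤cd = proj₂ is-cd (len σ) (i , j , σ , vi , proj₂ (simple-path (connected vi vj)) , refl)

  σ≤n : len σ ≤ n
  σ≤n = ℕₚ.≤-trans σ≤cd (ℕₚ.m+n≤o⇒m≤o cd cd+ep≤n)

  ep≤n∸σ : ep ≤ n ℕ.∸ len σ
  ep≤n∸σ = ℕₚ.m+n≤o⇒m≤o∸n ep (begin
    ep ℕ.+ len σ  ≤⟨ ℕₚ.+-monoʳ-≤ ep σ≤cd ⟩
    ep ℕ.+ cd     ≡⟨ ℕₚ.+-comm ep cd ⟩
    cd ℕ.+ ep     ≤⟨ cd+ep≤n ⟩
    n             ∎)
    where open ℕₚ.≤-Reasoning

  -- n + len δ differs from n ∸ len σ by the length of the closed path σ ◅◅ δ.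
  c∣n∸σ : c ∣ n ℕ.∸ len σ
  c∣n∸σ = ∣m+n∣m⇒∣n (subst (c ∣_) split c∣n+δ)
    (subst (c ∣_) (trans (len-◅◅ σ δ) (ℕₚ.+-comm (len σ) (len δ))) (c∣closed H is-c (σ ◅◅ δ)))
    where
    open ≡-Reasoning
    split : n ℕ.+ len δ ≡ (len δ ℕ.+ len σ) ℕ.+ (n ℕ.∸ len σ)
    split = begin
      n ℕ.+ len δ                            ≡⟨ ℕₚ.+-comm n (len δ) ⟩
      len δ ℕ.+ n                            ≡⟨ cong (len δ ℕ.+_) (ℕₚ.m+[n∸m]≡n σ≤n) ⟨
      len δ ℕ.+ (len σ ℕ.+ (n ℕ.∸ len σ))    ≡⟨ ℕₚ.+-assoc (len δ) (len σ) _ ⟨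
      (len δ ℕ.+ len σ) ℕ.+ (n ℕ.∸ len σ)    ∎

-- Powers of a matrix and the finiteness of their entries

module _ (A : Matrix N) where

  finite-power⇒path : ∀ n → Finite ((A ^⊗ n) i j) → HasPath (G A) n i j
  finite-power⇒path {i} {j} ℕ.zero fin with i Fin.≟ j
  ... | yes refl = ε , refl
  ... | no  _    = contradiction refl fin
  finite-power⇒path {i} {j} (ℕ.suc n) fin
    with k , fin-k ← finite-⨆ (λ k → A i k + (A ^⊗ n) k j) fin
    with γ , lenγ≡n ← finite-power⇒path n (finite-+ʳ {A i k} fin-k)
    = finite-+ˡ fin-k ◅ γ , cong ℕ.suc lenγ≡n

  path⇒finite-power : (γ : Path (G A) i j) → Finite ((A ^⊗ len γ) i j)
  path⇒finite-power {i} ε with i Fin.≟ i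
  ... | yes _   = λ ()
  ... | no  i≢i = contradiction refl i≢i
  path⇒finite-power {i} {j} (_◅_ {j = k} e γ) =
    finite-≤ (⨆-upper (λ k → A i k + (A ^⊗ len γ) k j) k)
      (finite-+ e (path⇒finite-power γ))

  -- Here c is the cyclicity of G(A): the finiteness pattern of the powers is
  -- c-periodic from cd + ep on, in both directions.
  module _ (connected : IsStronglyConnected (G A)) {cd} (is-cd : Is-cd (G A) cd)
           {ep} (is-ep : Is-ep (G A) ep) where

    private
      c    = proj₁ is-ep
      is-c = proj₁ (proj₂ is-ep)

    finite-at : (δ : Path (G A) j i) → cd ℕ.+ ep ≤ n → c ∣ n ℕ.+ len δ →
      Finite ((A ^⊗ n) i j)
    finite-at δ cd+ep≤n c∣n+δ
      with γ , refl ← path-of-length (G A) connected is-cd is-ep _ δ _ cd+ep≤n c∣n+δ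
      = path⇒finite-power γ

    c∣return : (δ : Path (G A) j i) → ∀ n → Finite ((A ^⊗ n) i j) → c ∣ n ℕ.+ len δ
    c∣return δ n fin with γ , refl ← finite-power⇒path n fin
      = subst (c ∣_) (len-◅◅ γ δ) (c∣closed (G A) is-c (γ ◅◅ δ))

    finite-forward : cd ℕ.+ ep ≤ n → c ∣ p → Finite ((A ^⊗ n) i j) →
      Finite ((A ^⊗ (n ℕ.+ p)) i j)
    finite-forward {n} {p} cd+ep≤n c∣p fin =
      finite-at δ (ℕₚ.m≤n⇒m≤n+o p cd+ep≤n) (subst (c ∣_) p+n+δ≡n+p+δ
        (∣m∣n⇒∣m+n c∣p (c∣return δ n fin)))
      where
      δ = proj₂ connected _ _
      p+n+δ≡n+p+δ : p ℕ.+ (n ℕ.+ len δ) ≡ n ℕ.+ p ℕ.+ len δ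
      p+n+δ≡n+p+δ = trans (sym (ℕₚ.+-assoc p n (len δ)))
        (cong (ℕ._+ len δ) (ℕₚ.+-comm p n))

    finite-backward : cd ℕ.+ ep ≤ n → c ∣ p → Finite ((A ^⊗ (n ℕ.+ p)) i j) →
      Finite ((A ^⊗ n) i j)
    finite-backward {n} {p} cd+ep≤n c∣p fin =
      finite-at δ cd+ep≤n (∣m+n∣m⇒∣n (subst (c ∣_) n+p+δ≡p+n+δ (c∣return δ (n ℕ.+ p) fin)) c∣p)
      where
      δ = proj₂ connected _ _
      n+p+δ≡p+n+δ : n ℕ.+ p ℕ.+ len δ ≡ p ℕ.+ (n ℕ.+ len δ)
      n+p+δ≡p+n+δ = trans (cong (ℕ._+ len δ) (ℕₚ.+-comm n p)) (ℕₚ.+-assoc p n (len δ))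

    -- A large multiple s of c is the length of a closed path at a node v.  By
    -- periodicity the diagonal entry is then finite at s ∸ p as well, so c
    -- divides both s and s ∸ p.
    period-divisible : PeriodicFrom (λ n → uncurry (A ^⊗ n)) p m → c ∣ p
    period-divisible {p} {m} (w , periodic) =
      ∣m+n∣m⇒∣n (subst (c ∣_) (sym r+p≡s) c∣s) (c∣diagonal r finite-r)
      where
      v = proj₁ (proj₁ connected)
      b = cd ℕ.+ ep ℕ.+ m ℕ.+ p
      s = b ℕ.* c
      r = s ℕ.∸ p

      instance
        c≢0 : NonZero c
        c≢0 = ℕ.>-nonZero (1≤c (G A) is-c)

      b≤s : b ≤ s
      b≤s = ℕₚ.m≤m*n b c

      r+p≡s : r ℕ.+ p ≡ s
      r+p≡s = ℕₚ.m∸n+n≡m (ℕₚ.m+n≤o⇒n≤o (cd ℕ.+ ep ℕ.+ m) b≤s)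

      c∣s : c ∣ s
      c∣s = n∣m*n b

      finite-s : Finite ((A ^⊗ s) v v)
      finite-s = finite-at ε
        (ℕₚ.m+n≤o⇒m≤o (cd ℕ.+ ep) (ℕₚ.m+n≤o⇒m≤o (cd ℕ.+ ep ℕ.+ m) b≤s))
        (subst (c ∣_) (sym (ℕₚ.+-identityʳ s)) c∣s)

      m≤r : m ≤ r
      m≤r = ℕₚ.m+n≤o⇒m≤o∸n m
        (ℕₚ.≤-trans (ℕₚ.+-monoˡ-≤ p (ℕₚ.m≤n+m m (cd ℕ.+ ep))) b≤s)

      finite-r : Finite ((A ^⊗ r) v v)
      finite-r = finite-+ˡ (finite-≈ (periodic r m≤r (v , v))
        (subst (λ l → Finite ((A ^⊗ l) v v)) (sym r+p≡s) finite-s))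

      c∣diagonal : ∀ n → Finite ((A ^⊗ n) v v) → c ∣ n
      c∣diagonal n fin = subst (c ∣_) (ℕₚ.+-identityʳ n) (c∣return ε n fin)

  -- The value 0 of v^ μ j at j picks out the entry (i , j), and the bound μ
  -- on the differences keeps the other terms below it.
  column-entry : ∀ {B μ} → Is-μ A B μ → B ≤ n → ∀ {a} → (A ^⊗ n) i j ≡ [ a ] →
    (A ^⊗ n ⊗ᵥ v^ μ j) i ≈ [ a ]
  column-entry {n} {i} {j} {B} {μ} (upper , _) B≤n {a} Aij≡a =
    ⨆-attained (λ k → (A ^⊗ n) i k + v^ μ j k) j term-j term-k
    where
    term-j : (A ^⊗ n) i j + v^ μ j j ≈ [ a ]
    term-j with j Fin.≟ j
    ... | yes _   = ≈-trans (+-identityʳ ((A ^⊗ n) i j)) (≈-reflexive Aij≡a)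
    ... | no  j≢j = contradiction refl j≢j

    ≈⇒≤ : ∀ {x y} → x ≈ y → x Max.≤ y
    ≈⇒≤ ⊥₋≈⊥₋       = ⊥₋≤ _
    ≈⇒≤ [ x≤y , _ ] = [ x≤y ]

    term-k : ∀ k → (A ^⊗ n) i k + v^ μ j k Max.≤ [ a ]
    term-k k with k Fin.≟ j
    ... | yes refl = ≈⇒≤ (≈-trans (+-identityʳ ((A ^⊗ n) i k)) (≈-reflexive Aij≡a))
    ... | no  _    = swap-subtrahend ((A ^⊗ n) i k)
      (upper _ (i , j , k , n , a , B≤n , Aij≡a , refl))

-- Multiples of a period

PeriodicFrom-* : ∀ {I : Set} (f : ℕ → I → ℝmax) → PeriodicFrom f p m →
  ∀ k → PeriodicFrom f (k ℕ.* p) m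
PeriodicFrom-* f periodic ℕ.zero = [ 0ℝ ] , λ n _ x →
  ≈-trans (≈-reflexive (cong (λ l → f l x) (ℕₚ.+-identityʳ n))) (≈-sym (+-identityʳ (f n x)))
PeriodicFrom-* {p} f periodic@(w , shift) (ℕ.suc k)
  with W , shifts ← PeriodicFrom-* f periodic k
  = w + W , λ n m≤n x →
  ≈-trans (≈-reflexive (cong (λ l → f l x) (sym (ℕₚ.+-assoc n p (k ℕ.* p)))))
  (≈-trans (shifts (n ℕ.+ p) (ℕₚ.m≤n⇒m≤n+o p m≤n) x)
  (≈-trans (+-congʳ W (shift n m≤n x)) (+-assoc (f n x) w W)))

-- The bound on the transient

foldr-⊔-base : ∀ b (f : Vector ℕ N) → b ≤ foldr _⊔_ b f
foldr-⊔-base {ℕ.zero}  b f = ℕₚ.≤-refl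
foldr-⊔-base {ℕ.suc N} b f = ℕₚ.m≤n⇒m≤o⊔n (f zero) (foldr-⊔-base b λ l → f (suc l))

foldr-⊔-upper : ∀ b (f : Vector ℕ N) j → f j ≤ foldr _⊔_ b f
foldr-⊔-upper b f zero    = ℕₚ.m≤m⊔n (f zero) _
foldr-⊔-upper b f (suc j) = ℕₚ.m≤n⇒m≤o⊔n (f zero) (foldr-⊔-upper b (λ l → f (suc l)) j)

-- The subtracted 1 is compensated by ĉ ≥ 1.
cd+ep≤Bₘₛ : ∀ cd ep {ĉ} ep̂ → 1 ≤ ĉ → cd ℕ.+ ep ≤ 2 ℕ.* cd ℕ.+ ep ℕ.+ ĉ ℕ.+ ep̂ ℕ.∸ 1
cd+ep≤Bₘₛ cd ep {ĉ} ep̂ 1≤ĉ = ℕₚ.m+n≤o⇒m≤o∸n (cd ℕ.+ ep)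
  (ℕₚ.m≤n⇒m≤n+o ep̂ (ℕₚ.+-mono-≤ (ℕₚ.+-monoˡ-≤ ep (ℕₚ.m≤m+n cd (cd ℕ.+ 0))) 1≤ĉ))

theorem9 : ∀ {N} (A : Matrix N) → IsIrreducible A →
    ∀ {B} → Is-Bₘₛ A B →
    ∀ {μ} → Is-μ A B μ →
    ∀ {n-A} → IsMatrixTransient A n-A →
    ∀ {n-Av : Fin N → ℕ} → (∀ j → IsSystemTransient A (v^ μ j) (n-Av j)) →
    n-A ≤ foldr _⊔_ B n-Av
theorem9 {N} A (connected , _) {B}
  (cd , ep , ĉ , ep̂ , is-cd , is-ep , ((Ĥ , _ , is-ĉ) , _) , _ , refl)
  {μ} is-μ {n-A} (p , 1≤p , (w , periodic-A) , minimal) {n-Av} transient =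
  minimal t (w , λ n t≤n (i , j) → periodic n t≤n i j)
  where
  t = foldr _⊔_ B n-Av

  cd+ep≤B : cd ℕ.+ ep ≤ B
  cd+ep≤B = cd+ep≤Bₘₛ cd ep ep̂ (1≤c Ĥ is-ĉ)

  c∣p : proj₁ is-ep ∣ p
  c∣p = period-divisible A connected is-cd is-ep (w , periodic-A)

  module _ (n : ℕ) (t≤n : t ≤ n) (i j : Fin N) where

    B≤n : B ≤ n
    B≤n = ℕₚ.≤-trans (foldr-⊔-base B n-Av) t≤n

    cd+ep≤n : cd ℕ.+ ep ≤ n
    cd+ep≤n = ℕₚ.≤-trans cd+ep≤B B≤n

    n-Av≤n : n-Av j ≤ n
    n-Av≤n = ℕₚ.≤-trans (foldr-⊔-upper B n-Av j) t≤n

    q = proj₁ (transient j)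

    instance
      p≢0 : NonZero p
      p≢0 = ℕ.>-nonZero 1≤p

      q≢0 : NonZero q
      q≢0 = ℕ.>-nonZero (proj₁ (proj₂ (transient j)))

    S = n-A ℕ.* p ℕ.* q

    n-A≤S : n-A ≤ S
    n-A≤S = ℕₚ.≤-trans (ℕₚ.m≤m*n n-A p) (ℕₚ.m≤m*n (n-A ℕ.* p) q)

    c∣S : proj₁ is-ep ∣ S
    c∣S = ∣-trans c∣p (∣-trans (n∣m*n n-A) (m∣m*n q))

    x : ℕ → ℝmax
    x l = (A ^⊗ l ⊗ᵥ v^ μ j) i

    x-periodic : ∃[ W ] (∀ l → n-Av j ≤ l → x (l ℕ.+ S) ≈ x l + W)
    x-periodic with W , shift ← PeriodicFrom-* (λ l → A ^⊗ l ⊗ᵥ v^ μ j)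
                                  (proj₁ (proj₂ (proj₂ (transient j)))) (n-A ℕ.* p)
      = W , λ l n-Av≤l → shift l n-Av≤l i

    W = proj₁ x-periodic

    entry-shift : ∀ {l a a′} → n ≤ l → (A ^⊗ l) i j ≡ [ a ] →
      (A ^⊗ (l ℕ.+ S)) i j ≡ [ a′ ] → [ a′ ] ≈ [ a ] + W
    entry-shift {l} n≤l a≡ a′≡ =
      ≈-trans (≈-sym (column-entry A is-μ (ℕₚ.m≤n⇒m≤n+o S B≤l) a′≡))
      (≈-trans (proj₂ x-periodic l (ℕₚ.≤-trans n-Av≤n n≤l))
      (+-congʳ W (column-entry A is-μ B≤l a≡)))
      where
      B≤l : B ≤ l
      B≤l = ℕₚ.≤-trans B≤n n≤l

    matrix-shift : ∀ {a′ b′} → (A ^⊗ (n ℕ.+ S)) i j ≡ [ a′ ] →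
      (A ^⊗ (n ℕ.+ p ℕ.+ S)) i j ≡ [ b′ ] → [ b′ ] ≈ [ a′ ] + w
    matrix-shift a′≡ b′≡ =
      ≈-trans (≈-reflexive (trans (sym b′≡) (cong (λ l → (A ^⊗ l) i j) n+p+S≡n+S+p)))
      (≈-trans (periodic-A (n ℕ.+ S) (ℕₚ.m≤n⇒m≤o+n n n-A≤S) (i , j))
      (+-congʳ w (≈-reflexive a′≡)))
      where
      n+p+S≡n+S+p : n ℕ.+ p ℕ.+ S ≡ n ℕ.+ S ℕ.+ p
      n+p+S≡n+S+p = trans (ℕₚ.+-assoc n p S)
        (trans (cong (n ℕ.+_) (ℕₚ.+-comm p S)) (sym (ℕₚ.+-assoc n S p)))

    forward : ∀ {l r} → n ≤ l → proj₁ is-ep ∣ r → Finite ((A ^⊗ l) i j) →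
      Finite ((A ^⊗ (l ℕ.+ r)) i j)
    forward n≤l = finite-forward A connected is-cd is-ep (ℕₚ.≤-trans cd+ep≤n n≤l)

    -- As n ≥ cd + ep and c divides p, the two entries are finite together; this
    -- rules out the mixed cases.
    periodic : (A ^⊗ (n ℕ.+ p)) i j ≈ (A ^⊗ n) i j + w
    periodic with (A ^⊗ n) i j in a≡ | (A ^⊗ (n ℕ.+ p)) i j in b≡
    ... | -∞    | -∞    = ⊥₋≈⊥₋
    ... | -∞    | [ b ] = contradiction a≡
      (finite-backward A connected is-cd is-ep cd+ep≤n c∣p
        λ b≡-∞ → contradiction (trans (sym b≡) b≡-∞) λ ())
    ... | [ a ] | -∞    = contradiction b≡
      (forward ℕₚ.≤-refl c∣p λ a≡-∞ → contradiction (trans (sym a≡) a≡-∞) λ ())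
    ... | [ a ] | [ b ]
      with a′ , a′≡ ← finite-value (forward ℕₚ.≤-refl c∣S
                        λ a≡-∞ → contradiction (trans (sym a≡) a≡-∞) λ ())
      with b′ , b′≡ ← finite-value (forward (ℕₚ.m≤m+n n p) c∣S
                        λ b≡-∞ → contradiction (trans (sym b≡) b≡-∞) λ ())
      = cancel-drift (entry-shift ℕₚ.≤-refl a≡ a′≡)
          (entry-shift (ℕₚ.m≤m+n n p) b≡ b′≡) (matrix-shift a′≡ b′≡)
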